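{- There exists an absolute constant $c>0$ such that for every positive integer $n$ and every $n$-vertex graph $H$ with average degree $d$, we have $ER(H)\ge n^{cd}$.
   Context: Edge-colorings of $K_N$ may use arbitrarily many colors. A copy of $H$ in $K_N$ (injective $\varphi:V(H)\to V(K_N)$) is canonically colored if it is monochromatic (all edges same color), rainbow (all edges distinct colors), or lexicographic: there is an ordering $v_1,\dots,v_n$ of $V(H)$ such that for each $i$ all edges $\varphi(v_i)\varphi(v_j)$ with $v_iv_j\in E(H)$, $j>i$, have the same color $c_i$, and these colors are distinct for different $v_i$. $ER(H)$ is the least $N$ such that every edge-coloring of $K_N$ contains a canonically colored copy of $H$. -}

module Defs where

open import Data.Nat using (ℕ; _<_; _+_; _≤_)
open import Data.Bool using (Bool; true; false; T)
open import Data.Fin using (Fin; toℕ)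
open import Data.Nat.Properties using (_<?_)
open import Data.List using (List; length; filter; allFin; concatMap; map)
open import Data.Product using (Σ; ∃; ∃-syntax; _×_; _,_)
open import Data.Sum using (_⊎_)
open import Function.Definitions using (Injective)
open import Relation.Binary.PropositionalEquality using (_≡_)
open import Relation.Nullary using (¬_)
open import Relation.Nullary.Decidable using (_×-dec_)
open import Data.Bool.Properties using (T?)

record Graph (n : ℕ) : Set where
  field
    adj   : Fin n → Fin n → Bool
    sym   : ∀ u v → adj u v ≡ adj v u
    irref : ∀ u → adj u u ≡ false
open Graph public

Adj : ∀ {n} → Graph n → Fin n → Fin n → Set
Adj H u v = T (adj H u v)

allPairs : ∀ n → List (Fin n × Fin n)
allPairs n = concatMap (λ i → map (λ j → (i , j)) (allFin n)) (allFin n)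

edges : ∀ {n} → Graph n → ℕ
edges {n} H = length (filter (λ { (i , j) → (toℕ i <? toℕ j) ×-dec T? (adj H i j) }) (allPairs n))

-- An edge-colouring of K_N with arbitrarily many colours (colours in ℕ;
-- only the values on pairs i ≠ j matter).
record Colouring (N : ℕ) : Set where
  field
    col    : Fin N → Fin N → ℕ
    colSym : ∀ i j → col i j ≡ col j i
open Colouring public

module _ {n N : ℕ} (H : Graph n) (χ : Colouring N) (φ : Fin n → Fin N) where

  c : Fin n → Fin n → ℕ
  c u v = col χ (φ u) (φ v)

  Monochromatic : Set
  Monochromatic = ∃[ a ] (∀ u v → Adj H u v → c u v ≡ a)

  Rainbow : Set
  Rainbow = ∀ u v u′ v′ → Adj H u v → Adj H u′ v′ → c u v ≡ c u′ v′ →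
            (u ≡ u′ × v ≡ v′) ⊎ (u ≡ v′ × v ≡ u′)

  -- There is an ordering v_1..v_n of V(H) (given by the injective position
  -- map pos : Fin n → Fin n, v_i = the vertex at position i) and colours
  -- c_v, distinct for distinct vertices, such that every edge uv with u
  -- before v gets colour c_u.
  Lexicographic : Set
  Lexicographic =
    Σ (Fin n → Fin n) λ pos → Injective _≡_ _≡_ pos ×
    Σ (Fin n → ℕ) λ cv → Injective _≡_ _≡_ cv ×
    (∀ u v → Adj H u v → toℕ (pos u) < toℕ (pos v) → c u v ≡ cv u)

  Canonical : Set
  Canonical = Monochromatic ⊎ Rainbow ⊎ Lexicographic

ERProperty : ∀ {n} → Graph n → ℕ → Set
ERProperty {n} H N = (χ : Colouring N) →
  Σ (Fin n → Fin N) λ φ → Injective _≡_ _≡_ φ × Canonical H χ φ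

-- Colour K_N uniformly at random with n colours.  If H has more than n edges, no copy is rainbow.
-- A monochromatic or lexicographic copy is determined on its edges by the embedding, the positions
-- of the vertices and the colour of each vertex, so by at most (N n²)ⁿ patterns, and each pattern
-- prescribes the colours of e(H) edges of K_N, hence occurs with probability n^(-e(H)).  So
-- n^(e(H)) ≤ (N n²)ⁿ ≤ N^(3n).  With at most n edges the trivial bound n ≤ N suffices.
module Submission where

open import Defs hiding (sym)
open import Data.Nat using (ℕ; _≤_; _*_; _^_)
open import Data.Product using (∃-syntax; _×_)

import Algebra.Properties.Semiring.Sum
open import Data.Bool using (T; true; false; if_then_else_)
open import Data.Bool.Properties using (T?)
open import Data.Empty using (⊥-elim)
open import Data.Fin using (Fin; zero; suc; toℕ; combine; remQuot; finToFun; funToFin)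
import Data.Fin.Properties as Fin
open import Data.List using (List; []; _∷_; _++_; length; map; filter; lookup; tabulate; allFin; concatMap; cartesianProduct)
import Data.List.Properties as List
open import Data.List.Membership.Propositional using (lose)
open import Data.List.Membership.Propositional.Properties using (∈-filter⁺; ∈-tabulate⁺; ∈-lookup)
open import Data.List.Relation.Unary.All as All using (All; []; _∷_)
import Data.List.Relation.Unary.All.Properties as All
open import Data.List.Relation.Unary.AllPairs using (_∷_)
open import Data.List.Relation.Unary.Any using (Any; here; there)
import Data.List.Relation.Unary.Any.Properties as Any
open import Data.List.Relation.Unary.Unique.Propositional using (Unique)
import Data.List.Relation.Unary.Unique.Propositional.Properties as Unique
open import Data.Maybe using (Maybe; just; nothing; Is-just)
import Data.Maybe.Relation.Unary.All as Maybe
open import Data.Maybe.Relation.Unary.Any using (just)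
open import Data.Nat using (zero; suc; _+_; _<_; s≤s; z≤n; NonZero; >-nonZero; >-nonZero⁻¹)
open import Data.Nat.DivMod using (_mod_; m<n⇒m%n≡m; m%n<n)
import Data.Nat.ListAction as List
open import Data.Nat.Properties
open import Data.Product using (_,_; proj₁; proj₂; map₂)
open import Data.Sum using (_⊎_; inj₁; inj₂)
open import Data.Unit using (tt)
open import Data.Vec.Functional using (updateAt)
import Data.Vec.Functional as Vector
open import Data.Vec.Functional.Properties using (updateAt-minimal)
open import Function using (_∘_; const)
open import Function.Definitions using (Injective)
open import Relation.Binary.PropositionalEquality
open import Relation.Nullary using (Dec; yes; no; does; ¬_)
open import Relation.Nullary.Decidable using (_×-dec_; _→-dec_)

open Algebra.Properties.Semiring.Sum +-*-semiring
  using (sum; sum-cong-≗; sum-replicate-zero; ∑-distrib-+; *-distribʳ-sum)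

-- Partial maps and the union bound by counting extensions

PartialMap : ℕ → ℕ → Set
PartialMap m r = Fin m → Maybe (Fin r)

_Extends_ : ∀ {m r} → (Fin m → Fin r) → PartialMap m r → Set
f Extends p = ∀ c → Maybe.All (f c ≡_) (p c)

choices : ∀ {r} → Maybe (Fin r) → ℕ
choices {r} nothing  = r
choices     (just _) = 1

-- A partial map stands for the event that a random map extends it. Its probability is
-- `extensions p` out of `r ^ m`, and the product formula avoids listing maps.
extensions : ∀ {m r} → PartialMap m r → ℕ
extensions {zero}  p = 1
extensions {suc m} p = choices (p zero) * extensions (p ∘ suc)

totalExtensions : ∀ {m r} → List (PartialMap m r) → ℕ
totalExtensions = List.sum ∘ map extensions

Allows : ∀ {r} → Maybe (Fin r) → Fin r → Set
Allows x a = Maybe.All (a ≡_) x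

allows? : ∀ {r} (x : Maybe (Fin r)) a → Dec (Allows x a)
allows? x a = Maybe.dec (a Fin.≟_) x

indicator : ∀ {p} {P : Set p} → Dec P → ℕ
indicator P? = if does P? then 1 else 0

-- Conditions the events on the first value being `a`, for the induction in `covering-bound`.
restrict : ∀ {m r} → Fin r → List (PartialMap (suc m) r) → List (PartialMap m r)
restrict a L = map (_∘ suc) (filter (λ p → allows? (p zero) a) L)

sum-mono : ∀ {n} {f g : Fin n → ℕ} → (∀ i → f i ≤ g i) → sum f ≤ sum g
sum-mono {zero}  f≤g = z≤n
sum-mono {suc n} f≤g = +-mono-≤ (f≤g zero) (sum-mono (f≤g ∘ suc))

sum-const : ∀ n x → sum {n} (const x) ≡ n * x
sum-const zero    x = refl
sum-const (suc n) x = cong (x +_) (sum-const n x)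

∑-indicator-≡ : ∀ {r} (b : Fin r) → sum (λ a → indicator (a Fin.≟ b)) ≡ 1
∑-indicator-≡ {suc r} zero    = cong suc (sum-replicate-zero r)
∑-indicator-≡ {suc r} (suc b) = ∑-indicator-≡ b

∑-allows : ∀ {r} (x : Maybe (Fin r)) → sum (λ a → indicator (allows? x a)) ≡ choices x
∑-allows {r} nothing  = trans (sum-const r 1) (*-identityʳ r)
∑-allows     (just b) = ∑-indicator-≡ b

totalExtensions-restrict-∷ : ∀ {m r} (a : Fin r) p (L : List (PartialMap (suc m) r)) →
  totalExtensions (restrict a (p ∷ L)) ≡
  indicator (allows? (p zero) a) * extensions (p ∘ suc) + totalExtensions (restrict a L)
totalExtensions-restrict-∷ a p L with does (allows? (p zero) a)
... | true  = cong (_+ totalExtensions (restrict a L)) (sym (*-identityˡ (extensions (p ∘ suc))))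
... | false = refl

-- Each extension of a partial map has exactly one first value `a`, so it is counted in exactly one
-- restriction.
∑-restrict : ∀ {m r} (L : List (PartialMap (suc m) r)) →
  sum (λ a → totalExtensions (restrict a L)) ≡ totalExtensions L
∑-restrict {r = r} []      = sum-replicate-zero r
∑-restrict {r = r} (p ∷ L) = begin
  sum (λ a → totalExtensions (restrict a (p ∷ L)))
    ≡⟨ sum-cong-≗ (λ a → totalExtensions-restrict-∷ a p L) ⟩
  sum (λ a → allowed a * w + totalExtensions (restrict a L))
    ≡⟨ ∑-distrib-+ (λ a → allowed a * w) _ ⟩
  sum (λ a → allowed a * w) + sum (λ a → totalExtensions (restrict a L))
    ≡⟨ cong₂ _+_ (sym (*-distribʳ-sum w allowed)) (∑-restrict L) ⟩
  sum allowed * w + totalExtensions L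
    ≡⟨ cong (λ s → s * w + totalExtensions L) (∑-allows (p zero)) ⟩
  totalExtensions (p ∷ L) ∎
  where
  open ≡-Reasoning
  w : ℕ
  w = extensions (p ∘ suc)
  allowed : Fin r → ℕ
  allowed a = indicator (allows? (p zero) a)

restrict-covers : ∀ {m r} (a : Fin r) (f : Fin m → Fin r) {L} →
  Any ((a Vector.∷ f) Extends_) L → Any (f Extends_) (restrict a L)
restrict-covers a f {p ∷ L} cov with allows? (p zero) a | cov
... | yes _ | here ext  = here (ext ∘ suc)
... | yes _ | there cov = there (restrict-covers a f cov)
... | no ¬p | here ext  = ⊥-elim (¬p (ext zero))
... | no _  | there cov = restrict-covers a f cov

-- Induction on `m`: for each first value `a` the restricted list covers all maps on the remaining
-- arguments, and the `r` totals add up by `∑-restrict`. For `m = 0` the list cannot be empty, and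
-- its members count 1 each.
covering-bound : ∀ m {r} (L : List (PartialMap m r)) →
  (∀ f → Any (f Extends_) L) → r ^ m ≤ totalExtensions L
covering-bound zero    []      covers with covers (λ ())
... | ()
covering-bound zero    (p ∷ L) covers = s≤s z≤n
covering-bound (suc m) {r} L covers = begin
  r * r ^ m                                   ≡⟨ sum-const r (r ^ m) ⟨
  sum {r} (const (r ^ m))                     ≤⟨ sum-mono (λ a → covering-bound m (restrict a L)
                                                   (λ f → restrict-covers a f (covers (a Vector.∷ f)))) ⟩
  sum (λ a → totalExtensions (restrict a L))  ≡⟨ ∑-restrict L ⟩
  totalExtensions L                           ∎
  where open ≤-Reasoning

extensions-≤ : ∀ {m r} .{{_ : NonZero r}} (p : PartialMap m r) → extensions p ≤ r ^ m
extensions-≤ {zero}      p = ≤-refl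
extensions-≤ {suc m} {r} p = *-mono-≤ (choices-≤ (p zero)) (extensions-≤ (p ∘ suc))
  where
  choices-≤ : (x : Maybe (Fin r)) → choices x ≤ r
  choices-≤ nothing  = ≤-refl
  choices-≤ (just _) = >-nonZero⁻¹ r

-- A defined entry contributes the factor 1 to the product; once freed it contributes `r`.
extensions-erase : ∀ {m r} (p : PartialMap m r) c → Is-just (p c) →
  extensions (updateAt p c (const nothing)) ≡ extensions p * r
extensions-erase {suc m} {r} p zero    defined with p zero | defined
... | just _ | _ = trans (*-comm r w) (cong (_* r) (sym (*-identityˡ w)))
  where
  w : ℕ
  w = extensions (p ∘ suc)
extensions-erase {suc m} {r} p (suc c) defined = trans
  (cong (choices (p zero) *_) (extensions-erase (p ∘ suc) c defined))
  (sym (*-assoc (choices (p zero)) _ r))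

-- The event has probability at most `r ^ (- e)`, written without division. The entries `σ i` are
-- erased one at a time, each gaining a factor `r`, and no count exceeds `r ^ m`. Injectivity of `σ`
-- keeps the later entries defined.
extensions-bound : ∀ {m r} .{{_ : NonZero r}} e (p : PartialMap m r) (σ : Fin e → Fin m) →
  Injective _≡_ _≡_ σ → (∀ i → Is-just (p (σ i))) → extensions p * r ^ e ≤ r ^ m
extensions-bound zero p σ σ-inj defined =
  ≤-trans (≤-reflexive (*-identityʳ _)) (extensions-≤ p)
extensions-bound {m} {r} (suc e) p σ σ-inj defined = begin
  extensions p * (r * r ^ e)  ≡⟨ *-assoc (extensions p) r _ ⟨
  extensions p * r * r ^ e    ≡⟨ cong (_* r ^ e) (extensions-erase p (σ zero) (defined zero)) ⟨
  extensions p′ * r ^ e       ≤⟨ extensions-bound e p′ (σ ∘ suc) (Fin.suc-injective ∘ σ-inj) still-defined ⟩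
  r ^ m                       ∎
  where
  open ≤-Reasoning
  p′ : PartialMap m r
  p′ = updateAt p (σ zero) (const nothing)
  still-defined : ∀ i → Is-just (p′ (σ (suc i)))
  still-defined i = subst Is-just
    (sym (updateAt-minimal (σ (suc i)) (σ zero) p (λ eq → Fin.0≢1+n (sym (σ-inj eq)))))
    (defined (suc i))

totalExtensions-bound : ∀ {m r} e (L : List (PartialMap m r)) →
  All (λ p → extensions p * r ^ e ≤ r ^ m) L → totalExtensions L * r ^ e ≤ length L * r ^ m
totalExtensions-bound e []      []       = z≤n
totalExtensions-bound {m} {r} e (p ∷ L) (b ∷ bs) = begin
  (extensions p + totalExtensions L) * r ^ e         ≡⟨ *-distribʳ-+ (r ^ e) (extensions p) _ ⟩
  extensions p * r ^ e + totalExtensions L * r ^ e   ≤⟨ +-mono-≤ b (totalExtensions-bound e L bs) ⟩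
  r ^ m + length L * r ^ m                           ∎
  where open ≤-Reasoning

-- Events of probability at most `r ^ (- e)` that cover the whole space number at least `r ^ e`.
union-bound : ∀ {m r} .{{_ : NonZero r}} e (L : List (PartialMap m r)) →
  (∀ f → Any (f Extends_) L) → All (λ p → extensions p * r ^ e ≤ r ^ m) L → r ^ e ≤ length L
union-bound {m} {r} e L covers bounds = *-cancelˡ-≤ (r ^ m) {{m^n≢0 r m}} (begin
  r ^ m * r ^ e              ≤⟨ *-monoˡ-≤ (r ^ e) (covering-bound m L covers) ⟩
  totalExtensions L * r ^ e  ≤⟨ totalExtensions-bound e L bounds ⟩
  length L * r ^ m           ≡⟨ *-comm (length L) _ ⟩
  r ^ m * length L           ∎)
  where open ≤-Reasoning

-- Colourings of K_N as functions on cells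

-- Edges of K_N are the cells (i , j) with i ≤ j of an N × N grid; the other cells stay unused.
cell : ∀ {N} → Fin N → Fin N → Fin (N * N)
cell i j with toℕ i ≤? toℕ j
... | yes _ = combine i j
... | no _  = combine j i

cell-sym : ∀ {N} (i j : Fin N) → cell i j ≡ cell j i
cell-sym i j with toℕ i ≤? toℕ j | toℕ j ≤? toℕ i
... | yes i≤j | yes j≤i with refl ← Fin.toℕ-injective (≤-antisym i≤j j≤i) = refl
... | yes _   | no _    = refl
... | no _    | yes _   = refl
... | no i≰j  | no j≰i  = ⊥-elim (j≰i (<⇒≤ (≰⇒> i≰j)))

cell-injective : ∀ {N} (i j k l : Fin N) → cell i j ≡ cell k l →
  (i ≡ k × j ≡ l) ⊎ (i ≡ l × j ≡ k)
cell-injective i j k l eq with toℕ i ≤? toℕ j | toℕ k ≤? toℕ l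
... | yes _ | yes _ = inj₁ (Fin.combine-injective i j k l eq)
... | yes _ | no _  = inj₂ (Fin.combine-injective i j l k eq)
... | no _  | yes _ with eq₁ , eq₂ ← Fin.combine-injective j i k l eq = inj₂ (eq₂ , eq₁)
... | no _  | no _  with eq₁ , eq₂ ← Fin.combine-injective j i l k eq = inj₁ (eq₂ , eq₁)

cellColouring : ∀ {N r} → (Fin (N * N) → Fin r) → Colouring N
cellColouring f = record
  { col    = λ i j → toℕ (f (cell i j))
  ; colSym = λ i j → cong (toℕ ∘ f) (cell-sym i j) }

-- The colours named by a canonical copy are arbitrary naturals. Reduction mod `r` brings them into
-- `Fin r` and fixes those that really occur.
toℕ-mod : ∀ {r} .{{_ : NonZero r}} (a : Fin r) → toℕ a mod r ≡ a
toℕ-mod {r} a = Fin.toℕ-injective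
  (trans (Fin.toℕ-fromℕ< (m%n<n (toℕ a) r)) (m<n⇒m%n≡m (Fin.toℕ<n a)))

-- Enumeration of the edges of H, and absence of rainbow copies

lookup-injective : ∀ {A : Set} {xs : List A} → Unique xs → ∀ i j → lookup xs i ≡ lookup xs j → i ≡ j
lookup-injective (x∉ ∷ u) zero    zero    eq = refl
lookup-injective (x∉ ∷ u) zero    (suc j) eq = ⊥-elim (All.lookup x∉ (∈-lookup j) eq)
lookup-injective (x∉ ∷ u) (suc i) zero    eq = ⊥-elim (All.lookup x∉ (∈-lookup i) (sym eq))
lookup-injective (x∉ ∷ u) (suc i) (suc j) eq = cong suc (lookup-injective u i j eq)

allPairs-unique : ∀ n → Unique (allPairs n)
allPairs-unique n = subst Unique (sym (go (allFin n)))
  (Unique.cartesianProduct⁺ (Unique.allFin⁺ n) (Unique.allFin⁺ n))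
  where
  go : ∀ is → concatMap (λ i → map (i ,_) (allFin n)) is ≡ cartesianProduct is (allFin n)
  go []       = refl
  go (i ∷ is) = cong (map (i ,_) (allFin n) ++_) (go is)

-- Each edge is oriented from its smaller to its larger end, so that it cannot appear a second time
-- reversed.
record EdgeEnumeration {n} (H : Graph n) (e : ℕ) : Set where
  field
    source target : Fin e → Fin n
    ordered  : ∀ i → toℕ (source i) < toℕ (target i)
    adjacent : ∀ i → Adj H (source i) (target i)
    distinct : ∀ i j → source i ≡ source j → target i ≡ target j → i ≡ j

  no-reversal : ∀ i j → source i ≡ target j → ¬ target i ≡ source j
  no-reversal i j s≡t t≡s = <-asym (ordered i)
    (subst₂ _<_ (cong toℕ (sym t≡s)) (cong toℕ (sym s≡t)) (ordered j))

edgeEnumeration : ∀ {n} (H : Graph n) → EdgeEnumeration H (edges H)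
edgeEnumeration {n} H = fromList _ (Unique.filter⁺ _ (allPairs-unique n)) (All.all-filter _ (allPairs n))
  where
  fromList : ∀ (xs : List (Fin n × Fin n)) → Unique xs →
    All (λ uv → toℕ (proj₁ uv) < toℕ (proj₂ uv) × Adj H (proj₁ uv) (proj₂ uv)) xs →
    EdgeEnumeration H (length xs)
  fromList xs uniq good = record
    { source   = proj₁ ∘ lookup xs
    ; target   = proj₂ ∘ lookup xs
    ; ordered  = λ i → proj₁ (All.lookup good (∈-lookup i))
    ; adjacent = λ i → proj₂ (All.lookup good (∈-lookup i))
    ; distinct = λ i j s≡ t≡ → lookup-injective uniq i j (cong₂ _,_ s≡ t≡) }

module _ {n} (H : Graph n) {e} (E : EdgeEnumeration H e) where
  open EdgeEnumeration E

  -- By pigeonhole two of the `e` edges share one of the `n` colours, and the enumeration never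
  -- lists an edge twice.
  ¬Rainbow : ∀ {N} → n < e → (f : Fin (N * N) → Fin n) (φ : Fin n → Fin N) →
    ¬ Rainbow H (cellColouring f) φ
  ¬Rainbow n<e f φ rainbow
    with i , j , i<j , same ← Fin.pigeonhole n<e (λ i → f (cell (φ (source i)) (φ (target i))))
    with rainbow _ _ _ _ (adjacent i) (adjacent j) (cong toℕ same)
  ... | inj₁ (s≡ , t≡)   = Fin.<⇒≢ i<j (distinct i j s≡ t≡)
  ... | inj₂ (s≡t , t≡s) = no-reversal i j s≡t t≡s

-- Patterns of monochromatic and lexicographic copies

-- A vertex v is sent to (φ v , position of v , colour of v).  Colours may repeat, so monochromatic
-- copies are covered too.  Positions may repeat as well; comparing them by ≤ in Follows makes every
-- pattern prescribe a colour for every edge.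
Pattern : ℕ → ℕ → Set
Pattern n N = Fin n → Fin N × Fin n × Fin n

module _ {n N : ℕ} (s : Pattern n N) where
  place : Fin n → Fin N
  place = proj₁ ∘ s

  position colour : Fin n → Fin n
  position = proj₁ ∘ proj₂ ∘ s
  colour   = proj₂ ∘ proj₂ ∘ s

module _ {n N : ℕ} (H : Graph n) where

  Follows : Pattern n N → (Fin (N * N) → Fin n) → Set
  Follows s f = ∀ u v → Adj H u v → toℕ (position s u) ≤ toℕ (position s v) →
    f (cell (place s u) (place s v)) ≡ colour s u

  Prescribes : Pattern n N → Fin (N * N) → Set
  Prescribes s c = ∃[ u ] ∃[ v ] (Adj H u v × toℕ (position s u) ≤ toℕ (position s v) ×
    cell (place s u) (place s v) ≡ c)

  prescribes? : ∀ s c → Dec (Prescribes s c)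
  prescribes? s c = Fin.any? λ u → Fin.any? λ v →
    T? (adj H u v) ×-dec (toℕ (position s u) ≤? toℕ (position s v)) ×-dec
    (cell (place s u) (place s v) Fin.≟ c)

  -- Several pairs may prescribe one cell, even with conflicting colours; the pair found by the
  -- search decides. This is harmless, since an `f` that follows `s` agrees with all of them.
  prescription : Pattern n N → PartialMap (N * N) n
  prescription s c with prescribes? s c
  ... | yes (u , _) = just (colour s u)
  ... | no _        = nothing

  prescription-defined : ∀ s c → Prescribes s c → Is-just (prescription s c)
  prescription-defined s c pre with prescribes? s c
  ... | yes _ = just tt
  ... | no ¬p = ⊥-elim (¬p pre)

  follows⇒extends : ∀ s f → Follows s f → f Extends prescription s
  follows⇒extends s f follows c with prescribes? s c
  ... | yes (u , v , uv , u≤v , refl) = Maybe.just (follows u v uv u≤v)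
  ... | no _                          = Maybe.nothing

  canonical⇒pattern : .{{_ : NonZero n}} → ∀ f φ → ¬ Rainbow H (cellColouring f) φ →
    Canonical H (cellColouring f) φ → ∃[ s ] (place s ≗ φ × Follows s f)
  canonical⇒pattern f φ ¬rainbow (inj₁ (a , mono)) =
    (λ u → φ u , u , a mod n) , (λ _ → refl) ,
    λ u v uv _ → trans (sym (toℕ-mod _)) (cong (_mod n) (mono u v uv))
  canonical⇒pattern f φ ¬rainbow (inj₂ (inj₁ rainbow)) = ⊥-elim (¬rainbow rainbow)
  canonical⇒pattern f φ ¬rainbow (inj₂ (inj₂ (pos , pos-inj , cv , _ , lex))) =
    (λ u → φ u , pos u , cv u mod n) , (λ _ → refl) ,
    λ u v uv u≤v → trans (sym (toℕ-mod _)) (cong (_mod n) (lex u v uv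
      -- `Follows` supplies `≤`, but `lex` needs `<`: adjacent vertices differ, hence so do their
      -- positions.
      (≤∧≢⇒< u≤v (λ eq → loopless u v uv (pos-inj (Fin.toℕ-injective eq))))))
    where
    loopless : ∀ u v → Adj H u v → ¬ u ≡ v
    loopless u .u uu refl = subst T (irref H u) uu

  -- Makes distinct edges of H land in distinct cells. Being decidable, it can filter the list of
  -- patterns.
  InjectivePlace : Pattern n N → Set
  InjectivePlace s = ∀ u v → place s u ≡ place s v → u ≡ v

  injectivePlace? : ∀ s → Dec (InjectivePlace s)
  injectivePlace? s = Fin.all? λ u → Fin.all? λ v → (place s u Fin.≟ place s v) →-dec (u Fin.≟ v)

  -- A pattern becomes `n` digits in base `N * (n * n)`, which both lists and counts the patterns.
  pack : Fin N × Fin n × Fin n → Fin (N * (n * n))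
  pack (i , j , a) = combine i (combine j a)

  unpack : Fin (N * (n * n)) → Fin N × Fin n × Fin n
  unpack = map₂ (remQuot n) ∘ remQuot (n * n)

  unpack-pack : ∀ t → unpack (pack t) ≡ t
  unpack-pack (i , j , a) = trans
    (cong (map₂ (remQuot n)) (Fin.remQuot-combine i (combine j a)))
    (cong (i ,_) (Fin.remQuot-combine j a))

  decode : Fin ((N * (n * n)) ^ n) → Pattern n N
  decode k = unpack ∘ finToFun k

  encode : Pattern n N → Fin ((N * (n * n)) ^ n)
  encode s = funToFin (pack ∘ s)

  decode-encode : ∀ s → decode (encode s) ≗ s
  decode-encode s u = trans (cong unpack (Fin.finToFun-funToFin (pack ∘ s) u)) (unpack-pack (s u))

  -- Decoding recovers a pattern only pointwise, so `Follows` has to be transported along `≗`.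
  follows-resp : ∀ {s s′} f → s′ ≗ s → Follows s f → Follows s′ f
  follows-resp f s′≗s follows u v uv u≤v rewrite s′≗s u | s′≗s v = follows u v uv u≤v

  patterns : List (Pattern n N)
  patterns = filter injectivePlace? (tabulate decode)

  length-patterns : length patterns ≤ (N * (n * n)) ^ n
  length-patterns = ≤-trans (List.length-filter injectivePlace? (tabulate decode))
    (≤-reflexive (List.length-tabulate decode))

  patterns-complete : ∀ s f → InjectivePlace s → Follows s f →
    Any (f Extends_) (map prescription patterns)
  patterns-complete s f inj follows = Any.map⁺ (lose
    (∈-filter⁺ injectivePlace? (∈-tabulate⁺ (encode s))
      (λ u v eq → inj u v (trans (sym (place≗ u)) (trans eq (place≗ v)))))
    (follows⇒extends _ f (follows-resp f (decode-encode s) follows)))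
    where
    place≗ : place (decode (encode s)) ≗ place s
    place≗ u = cong proj₁ (decode-encode s u)

  module _ {e} (E : EdgeEnumeration H e) where
    open EdgeEnumeration E

    prescription-extensions : .{{_ : NonZero n}} → ∀ s → InjectivePlace s →
      extensions (prescription s) * n ^ e ≤ n ^ (N * N)
    prescription-extensions s inj = extensions-bound e (prescription s) edgeCell edgeCell-injective
      (λ i → prescription-defined s (edgeCell i) (prescribes i))
      where
      edgeCell : Fin e → Fin (N * N)
      edgeCell i = cell (place s (source i)) (place s (target i))

      edgeCell-injective : Injective _≡_ _≡_ edgeCell
      edgeCell-injective {i} {j} eq with cell-injective _ _ _ _ eq
      ... | inj₁ (s≡ , t≡)   = distinct i j (inj _ _ s≡) (inj _ _ t≡)
      ... | inj₂ (s≡t , t≡s) = ⊥-elim (no-reversal i j (inj _ _ s≡t) (inj _ _ t≡s))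

      prescribes : ∀ i → Prescribes s (edgeCell i)
      -- Totality of `≤` gives every edge a prescription in some direction, also when its ends have
      -- equal positions. In the second case the edge is read backwards.
      prescribes i with ≤-total (toℕ (position s (source i))) (toℕ (position s (target i)))
      ... | inj₁ s≤t = source i , target i , adjacent i , s≤t , refl
      ... | inj₂ t≤s = target i , source i ,
        subst T (Graph.sym H (source i) (target i)) (adjacent i) , t≤s ,
        cell-sym (place s (target i)) (place s (source i))

    -- Every colouring with `n` colours has a canonical copy, which is not rainbow and so follows a
    -- listed pattern. Thus the prescriptions cover all colourings, and `union-bound` applies.
    many-edges-bound : .{{_ : NonZero n}} → n < e → ERProperty H N → n ^ e ≤ (N * (n * n)) ^ n
    many-edges-bound n<e er = ≤-trans
      (union-bound e (map prescription patterns) covers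
        (All.map⁺ (All.map (λ {s} → prescription-extensions s) (All.all-filter injectivePlace? (tabulate decode)))))
      (≤-trans (≤-reflexive (List.length-map prescription patterns)) length-patterns)
      where
      covers : ∀ f → Any (f Extends_) (map prescription patterns)
      covers f with φ , φ-inj , canonical ← er (cellColouring f)
        with s , place≗φ , follows ← canonical⇒pattern f φ (¬Rainbow H E n<e f φ) canonical =
        patterns-complete s f
          (λ u v eq → φ-inj (trans (sym (place≗φ u)) (trans eq (place≗φ v)))) follows

-- Deduction of the lower bound on N

ERProperty⇒≤ : ∀ {n N} (H : Graph n) → ERProperty H N → n ≤ N
-- The constant colouring serves only to extract an embedding.
ERProperty⇒≤ H er with φ , φ-inj , _ ← er (record { col = λ _ _ → 0 ; colSym = λ _ _ → refl }) =
  Fin.injective⇒≤ φ-inj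

half-exponent-bound : ∀ {n N} .{{_ : NonZero n}} (H : Graph n) → ERProperty H N →
  n ^ edges H ≤ N ^ (3 * n)
half-exponent-bound {n} {N} H er with edges H ≤? n
... | yes e≤n = begin
  n ^ edges H   ≤⟨ ^-monoˡ-≤ (edges H) n≤N ⟩
  N ^ edges H   ≤⟨ ^-monoʳ-≤ N {{N≢0}} (≤-trans e≤n (m≤n*m n 3)) ⟩
  N ^ (3 * n)   ∎
  where
  open ≤-Reasoning
  n≤N : n ≤ N
  n≤N = ERProperty⇒≤ H er
  N≢0 : NonZero N
  N≢0 = >-nonZero (≤-trans (>-nonZero⁻¹ n) n≤N)
... | no e≰n = begin
  n ^ edges H         ≤⟨ many-edges-bound H (edgeEnumeration H) (≰⇒> e≰n) er ⟩
  -- The extra factor 1 matches the unfolding of `N ^ 3` as `N * (N * (N * 1))`.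
  (N * (n * n)) ^ n   ≤⟨ ^-monoˡ-≤ n (*-monoʳ-≤ N (*-mono-≤ n≤N (≤-trans n≤N (≤-reflexive (sym (*-identityʳ N)))))) ⟩
  (N ^ 3) ^ n         ≡⟨ ^-*-assoc N 3 n ⟩
  N ^ (3 * n)         ∎
  where
  open ≤-Reasoning
  n≤N : n ≤ N
  n≤N = ERProperty⇒≤ H er

theorem2p2 : ∃[ k ] (1 ≤ k × ((n : ℕ) → 1 ≤ n → (H : Graph n) →
    (N : ℕ) → ERProperty H N → n ^ (2 * edges H) ≤ N ^ (k * n)))
-- With average degree d one has d n = 2 e(H), so taking n-th roots gives N ≥ n^(d/6), that is c =
-- 1/6. The 6 is the 3 of `half-exponent-bound`, doubled by squaring.
theorem2p2 = 6 , s≤s z≤n , λ n 1≤n H N er →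
  let instance n≢0 = >-nonZero 1≤n in
  begin
    n ^ (2 * edges H)    ≡⟨ cong (n ^_) (*-comm 2 (edges H)) ⟩
    n ^ (edges H * 2)    ≡⟨ ^-*-assoc n (edges H) 2 ⟨
    (n ^ edges H) ^ 2    ≤⟨ ^-monoˡ-≤ 2 (half-exponent-bound H er) ⟩
    (N ^ (3 * n)) ^ 2    ≡⟨ ^-*-assoc N (3 * n) 2 ⟩
    N ^ (3 * n * 2)      ≡⟨ cong (N ^_) (trans (*-comm (3 * n) 2) (sym (*-assoc 2 3 n))) ⟩
    N ^ (6 * n)          ∎
  where open ≤-Reasoning
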